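{- Let $\pi\in IP(n,k)$ and $\iota\in I(n,k)$ have common $A=\{a_1,\ldots,a_k\}$ and $C=\{1,c_2,\ldots,c_k,n+1\}$. If the equivalence index classes are equal, $[a_i]_\pi=[a_i]_\iota$ for $i=1,\ldots,k$, then each $\pi(i)$ is the rank of $\iota(i)$, describing where to move it when rearranging the elements of $\iota$ in order; in other words, the inverse permutation $\pi^-$ is a permutation of indices such that $$\iota(\pi^-(1))\le\iota(\pi^-(2))\le\cdots\le\iota(\pi^-(n)).$$
   Context: $[n]=\{1,\ldots,n\}$. $I(n,k)$ is the set of idempotent maps $\iota:[n]\to[n]$ ($\iota(\iota(x))=\iota(x)$ for all $x$) with image of cardinality $k$. For $\iota\in I(n,k)$, $A=\{a_1<\cdots<a_k\}$ is its set of fixed points, $[a_i]_\iota=\{x\in[n]:\iota(x)=a_i\}$, and $C=\{c_1,\ldots,c_k,c_{k+1}\}$ is given by $c_1=1$, $c_{i+1}=c_i+|[a_i]_\iota|$ (so $c_{k+1}=n+1$). An idempotent permutation of degree $k$ ($1\le k\le n$) is a permutation $\pi$ of $[n]$ together with a distinguished set of indices $A=\{a_1<\cdots<a_k\}\subseteq[n]$ such that the values $c_i=\pi(a_i)$ satisfy $1=c_1<c_2<\cdots<c_k$; put $c_{k+1}=n+1$, $C=\{c_1,\ldots,c_k,n+1\}$, and $[a_i]_\pi=\{x\in[n]:c_i\le\pi(x)<c_{i+1}\}$. $IP(n,k)$ denotes the set of idempotent permutations of degree $k$. $\pi^-$ is the inverse permutation of $\pi$. -}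

module Defs where

open import Data.Fin.Base as Fin using (Fin; toℕ; inject₁)
open import Data.Fin.Permutation using (Permutation′; _⟨$⟩ʳ_)
open import Data.Fin.Properties as Finₚ using (any?; _≟_)
open import Data.Nat.Base using (ℕ; zero; suc; _+_; _≤_; _<_)
open import Data.Product.Base using (∃; _×_)
open import Data.Vec.Base using (Vec; []; _∷_; _∷ʳ_; allFin; count; lookup; tabulate)
open import Level using (Level)
open import Relation.Binary.PropositionalEquality.Core using (_≡_)
open import Relation.Unary using (Pred; Decidable)

private
  variable
    n k : ℕ
    p : Level

-- The set [n] = {1,…,n} is represented by Fin n; pos recovers the element of
-- {1,…,n} that x stands for, so that c-values and ranks are counted from 1.
pos : Fin n → ℕ
pos x = suc (toℕ x)

card : {P : Pred (Fin n) p} → Decidable P → ℕ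
card {n = n} P? = count P? (allFin n)

record IdempotentMap (n k : ℕ) : Set where
  field
    map        : Fin n → Fin n
    idempotent : ∀ x → map (map x) ≡ map x
    image-card : card (λ y → any? (λ x → map x ≟ y)) ≡ k

module _ (ι : IdempotentMap n k) where
  open IdempotentMap ι

  FixedPoint : Pred (Fin n) _
  FixedPoint x = map x ≡ x

  mapClass : Fin n → Pred (Fin n) _
  mapClass y x = map x ≡ y

  mapClass-card : Fin n → ℕ
  mapClass-card y = card (λ x → map x ≟ y)

-- partialSums c (s₁ ∷ … ∷ sₖ) lists c₁,…,cₖ₊₁ with c₁ = c and cᵢ₊₁ = cᵢ + sᵢ.
partialSums : ℕ → Vec ℕ k → Vec ℕ (suc k)
partialSums c []       = c ∷ []
partialSums c (s ∷ ss) = c ∷ partialSums (c + s) ss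

-- The sequence c₁,…,cₖ₊₁ of ι, where a is meant to list the fixed points of ι
-- in increasing order.
mapC : IdempotentMap n k → (Fin k → Fin n) → Vec ℕ (suc k)
mapC ι a = partialSums 1 (tabulate (λ i → mapClass-card ι (a i)))

-- The distinguished set A is given by its increasing enumeration a₁ < … < aₖ,
-- which determines it and is determined by it.
record IdempotentPermutation (n k : ℕ) : Set where
  field
    perm         : Permutation′ n
    1≤k          : 1 ≤ k
    k≤n          : k ≤ n
    a            : Fin k → Fin n
    a-increasing : ∀ i j → i Fin.< j → a i Fin.< a j

  -- c₁,…,cₖ,cₖ₊₁ with cᵢ = π(aᵢ) for i ≤ k and cₖ₊₁ = n + 1
  permC : Vec ℕ (suc k)
  permC = tabulate (λ i → pos (perm ⟨$⟩ʳ a i)) ∷ʳ suc n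

  field
    c₁≡1         : lookup permC Fin.zero ≡ 1
    c-increasing : ∀ (i j : Fin k) → i Fin.< j →
                   (perm ⟨$⟩ʳ a i) Fin.< (perm ⟨$⟩ʳ a j)

  Distinguished : Pred (Fin n) _
  Distinguished x = ∃ λ i → a i ≡ x

  -- inject₁ i and suc i are the positions of cᵢ and cᵢ₊₁.
  permClass : Fin k → Pred (Fin n) _
  permClass i x = lookup permC (inject₁ i) ≤ pos (perm ⟨$⟩ʳ x)
                × pos (perm ⟨$⟩ʳ x) < lookup permC (Fin.suc i)

-- Position r (counted from 1) is a rank of f x: when the values of f are
-- rearranged in weakly increasing order, r is one of the positions taken up by
-- the value f x. With ties this is an interval of positions.
IsRank : (Fin n → Fin n) → Fin n → ℕ → Set
IsRank f x r = card (λ y → f y Finₚ.<? f x) < r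
             × r ≤ card (λ y → f y Finₚ.≤? f x)

{-# OPTIONS --safe #-}
module Submission where

-- The sequence c₁,…,cₖ₊₁ of ι is weakly increasing because it is a sequence of
-- partial sums, and by hypothesis it is also the sequence of π; hence the
-- classes [aᵢ], which π sends to the intervals [cᵢ, cᵢ₊₁), occur in the order of
-- their indices. Every x lies in the class of ι(x), as ι(x) is a fixed point
-- and so some aᵢ. Therefore π(x) ≤ π(y) forces ι(x) ≤ ι(y)
-- (perm-≤⇒map-≤), and this is the sortedness of ι ∘ π⁻.
--
-- The rank statement follows for any map f with this monotonicity property
-- (sorting⇒rank): f y < f x implies π(y) < π(x), which exactly π(x) - 1 indices
-- y satisfy, whereas π(y) ≤ π(x), which exactly π(x) indices y satisfy, implies
-- f y ≤ f x.

open import Defs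
open import Data.Bool.Base using (if_then_else_; true; false)
open import Data.Fin.Base as Fin using (Fin; toℕ; inject₁; _≤_)
open import Data.Fin.Permutation using (Permutation′; _⟨$⟩ʳ_; _⟨$⟩ˡ_; inverseʳ)
open import Data.Fin.Properties as Finₚ using (toℕ-inject₁; toℕ<n; toℕ≤n)
open import Data.Nat.Base as ℕ using (ℕ; zero; suc; _+_; z≤n; s≤s)
open import Data.Nat.Properties as ℕₚ using (+-0-commutativeMonoid)
open import Algebra.Properties.CommutativeMonoid.Sum +-0-commutativeMonoid using (sum; sum-permute; sum-replicate-zero)
open import Data.Product.Base using (_×_; _,_; proj₁; proj₂)
open import Data.Sum.Base using ([_,_]′)
open import Data.Vec.Base using (Vec; _∷_; []; allFin; count; lookup; tabulate)
open import Function.Base using (id; _∘_)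
open import Relation.Binary.PropositionalEquality
open import Relation.Nullary using (Dec; does; yes; no; contradiction)
open import Relation.Unary using (Pred; Decidable; _⊆_; _≐_)

private
  variable
    n k : ℕ

-- The 0/1 value of a decision; it turns a cardinality into a sum, and sums over
-- Fin n are invariant under permutation.
indicator : ∀ {a} {A : Set a} → Dec A → ℕ
indicator a? = if does a? then 1 else 0

count-tabulate : ∀ {a p} {A : Set a} {P : Pred A p} (P? : Decidable P) (f : Fin n → A) →
                 count P? (tabulate f) ≡ sum (λ x → indicator (P? (f x)))
count-tabulate {n = zero}  P? f = refl
count-tabulate {n = suc n} P? f with does (P? (f Fin.zero))
... | true  = cong suc (count-tabulate P? (f ∘ Fin.suc))
... | false = count-tabulate P? (f ∘ Fin.suc)

count-mono : ∀ {a p q} {A : Set a} {P : Pred A p} {Q : Pred A q}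
             (P? : Decidable P) (Q? : Decidable Q) → P ⊆ Q →
             (xs : Vec A n) → count P? xs ℕ.≤ count Q? xs
count-mono P? Q? P⊆Q []       = z≤n
count-mono P? Q? P⊆Q (x ∷ xs) with P? x | Q? x
... | yes _ | yes _ = s≤s (count-mono P? Q? P⊆Q xs)
... | yes p | no ¬q = contradiction (P⊆Q p) ¬q
... | no _  | yes _ = ℕₚ.m≤n⇒m≤1+n (count-mono P? Q? P⊆Q xs)
... | no _  | no _  = count-mono P? Q? P⊆Q xs

card-mono : ∀ {p q} {P : Pred (Fin n) p} {Q : Pred (Fin n) q}
            (P? : Decidable P) (Q? : Decidable Q) → P ⊆ Q → card P? ℕ.≤ card Q?
card-mono {n = n} P? Q? P⊆Q = count-mono P? Q? P⊆Q (allFin n)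

card-preimage : ∀ {p} {P : Pred (Fin n) p} (P? : Decidable P) (π : Permutation′ n) →
                card (λ x → P? (π ⟨$⟩ʳ x)) ≡ card P?
card-preimage P? π = begin
  card (λ x → P? (π ⟨$⟩ʳ x))            ≡⟨ count-tabulate (λ x → P? (π ⟨$⟩ʳ x)) id ⟩
  sum (λ x → indicator (P? (π ⟨$⟩ʳ x))) ≡⟨ sum-permute (λ x → indicator (P? x)) π ⟨
  sum (λ x → indicator (P? x))          ≡⟨ count-tabulate P? id ⟨
  card P?                               ∎
  where open ≡-Reasoning

sum-initial : ∀ {m} → m ℕ.≤ n → sum {n} (λ x → indicator (toℕ x ℕₚ.<? m)) ≡ m
sum-initial {n = n} z≤n       = sum-replicate-zero n
sum-initial         (s≤s m≤n) = cong suc (sum-initial m≤n)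

card-initial : ∀ {m} → m ℕ.≤ n → card {n} (λ x → toℕ x ℕₚ.<? m) ≡ m
card-initial {n = n} {m} m≤n = trans (count-tabulate {n = n} (λ x → toℕ x ℕₚ.<? m) id) (sum-initial m≤n)

-- The bound m is a natural number, so that m = toℕ r counts the x with
-- π(x) < r and m = pos r those with π(x) ≤ r.
card-perm-< : ∀ (π : Permutation′ n) {m} → m ℕ.≤ n →
              card (λ x → toℕ (π ⟨$⟩ʳ x) ℕₚ.<? m) ≡ m
card-perm-< π {m} m≤n = trans (card-preimage (λ x → toℕ x ℕₚ.<? m) π) (card-initial m≤n)

-- The hypothesis says that listing the indices in the order π⁻(1), π⁻(2), …
-- sorts the values of f.
sorting⇒rank : (π : Permutation′ n) (f : Fin n → Fin n) →
               (∀ x y → π ⟨$⟩ʳ x ≤ π ⟨$⟩ʳ y → f x ≤ f y) →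
               ∀ x → IsRank f x (pos (π ⟨$⟩ʳ x))
sorting⇒rank π f mono x = s≤s below , upTo
  where
  open ℕₚ.≤-Reasoning
  πx = π ⟨$⟩ʳ x

  below : card (λ y → f y Finₚ.<? f x) ℕ.≤ toℕ πx
  below = begin
    card (λ y → f y Finₚ.<? f x)
      ≤⟨ card-mono _ _ (λ {y} fy<fx → ℕₚ.≰⇒> (ℕₚ.<⇒≱ fy<fx ∘ mono x y)) ⟩
    card (λ y → toℕ (π ⟨$⟩ʳ y) ℕₚ.<? toℕ πx)
      ≡⟨ card-perm-< π (toℕ≤n πx) ⟩
    toℕ πx ∎

  upTo : pos πx ℕ.≤ card (λ y → f y Finₚ.≤? f x)
  upTo = begin
    pos πx
      ≡⟨ card-perm-< π (toℕ<n πx) ⟨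
    card (λ y → toℕ (π ⟨$⟩ʳ y) ℕₚ.<? pos πx)
      ≤⟨ card-mono _ _ (λ {y} πy<1+πx → mono y x (ℕ.s≤s⁻¹ πy<1+πx)) ⟩
    card (λ y → f y Finₚ.≤? f x) ∎

partialSums-≥ : ∀ c (ss : Vec ℕ k) i → c ℕ.≤ lookup (partialSums c ss) i
partialSums-≥ c []       Fin.zero    = ℕₚ.≤-refl
partialSums-≥ c (s ∷ ss) Fin.zero    = ℕₚ.≤-refl
partialSums-≥ c (s ∷ ss) (Fin.suc i) = ℕₚ.≤-trans (ℕₚ.m≤m+n c s) (partialSums-≥ (c + s) ss i)

partialSums-mono : ∀ c (ss : Vec ℕ k) {i j} → i ≤ j →
                   lookup (partialSums c ss) i ℕ.≤ lookup (partialSums c ss) j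
partialSums-mono c []       {Fin.zero}  {j}         _         = partialSums-≥ c [] j
partialSums-mono c (s ∷ ss) {Fin.zero}  {j}         _         = partialSums-≥ c (s ∷ ss) j
partialSums-mono c (s ∷ ss) {Fin.suc i} {Fin.suc j} (s≤s i≤j) = partialSums-mono (c + s) ss i≤j

module _ (π : IdempotentPermutation n k) (ι : IdempotentMap n k) where
  open IdempotentPermutation π
  open IdempotentMap ι

  -- If j < i then cⱼ₊₁ ≤ cᵢ, so that the class of aⱼ precedes that of aᵢ.
  permClass-ordered : permC ≡ mapC ι a → ∀ {i j x y} →
                      permClass i x → permClass j y →
                      perm ⟨$⟩ʳ x ≤ perm ⟨$⟩ʳ y → i ≤ j
  permClass-ordered permC≡mapC {i} {j} {x} {y} (cᵢ≤πx , _) (_ , πy<cⱼ₊₁) πx≤πy =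
    ℕₚ.≮⇒≥ λ j<i → ℕₚ.<⇒≱ πy<cⱼ₊₁ (begin
      lookup permC (Fin.suc j)       ≡⟨ cong (λ c → lookup c (Fin.suc j)) permC≡mapC ⟩
      lookup (mapC ι a) (Fin.suc j)  ≤⟨ partialSums-mono 1 (tabulate (mapClass-card ι ∘ a))
                                         (subst (suc (toℕ j) ℕ.≤_) (sym (toℕ-inject₁ i)) j<i) ⟩
      lookup (mapC ι a) (inject₁ i)  ≡⟨ cong (λ c → lookup c (inject₁ i)) permC≡mapC ⟨
      lookup permC (inject₁ i)       ≤⟨ cᵢ≤πx ⟩
      pos (perm ⟨$⟩ʳ x)              ≤⟨ s≤s πx≤πy ⟩
      pos (perm ⟨$⟩ʳ y)              ∎)
    where open ℕₚ.≤-Reasoning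

  a-mono : ∀ {i j} → i ≤ j → a i ≤ a j
  a-mono {i} {j} i≤j =
    [ (λ i<j → ℕₚ.<⇒≤ (a-increasing i j i<j))
    , (λ i≡j → ℕₚ.≤-reflexive (cong (toℕ ∘ a) (Finₚ.toℕ-injective i≡j)))
    ]′ (ℕₚ.m≤n⇒m<n∨m≡n i≤j)

  perm-≤⇒map-≤ : Distinguished ≐ FixedPoint ι →
                 permC ≡ mapC ι a →
                 (∀ i → permClass i ≐ mapClass ι (a i)) →
                 ∀ x y → perm ⟨$⟩ʳ x ≤ perm ⟨$⟩ʳ y → map x ≤ map y
  perm-≤⇒map-≤ A≐Fix permC≡mapC classes x y πx≤πy
    with proj₂ A≐Fix (idempotent x) | proj₂ A≐Fix (idempotent y)
  ... | i , aᵢ≡ιx | j , aⱼ≡ιy =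
    subst₂ _≤_ aᵢ≡ιx aⱼ≡ιy
      (a-mono (permClass-ordered permC≡mapC
        (proj₂ (classes i) (sym aᵢ≡ιx)) (proj₂ (classes j) (sym aⱼ≡ιy)) πx≤πy))

theorem3p12 : ∀ (n k : ℕ) (π : IdempotentPermutation n k) (ι : IdempotentMap n k) →
    let open IdempotentPermutation π
        open IdempotentMap ι in
    Distinguished ≐ FixedPoint ι →
    permC ≡ mapC ι a →
    (∀ (i : Fin k) → permClass i ≐ mapClass ι (a i)) →
    (∀ (x : Fin n) → IsRank map x (pos (perm ⟨$⟩ʳ x))) ×
    (∀ (r s : Fin n) → r ≤ s → map (perm ⟨$⟩ˡ r) ≤ map (perm ⟨$⟩ˡ s))
theorem3p12 n k π ι A≐Fix permC≡mapC classes =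
  sorting⇒rank perm map mono ,
  λ r s r≤s → mono (perm ⟨$⟩ˡ r) (perm ⟨$⟩ˡ s)
    (subst₂ _≤_ (sym (inverseʳ perm)) (sym (inverseʳ perm)) r≤s)
  where
  open IdempotentPermutation π
  open IdempotentMap ι
  mono = perm-≤⇒map-≤ π ι A≐Fix permC≡mapC classes
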